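{- Let $G=G_1 \square G_2 \square \cdots \square G_k$ with $k\geq 2$ be a connected graph decomposed into its Cartesian prime factors, and let $f$ be a (total) coloring of $G$. If for each $i=1,\ldots,k$ the reduced-factor coloring $G_i^f$ is a distinguishing (total) coloring of $G_i$, and $G_i^f \not\simeq G_j^f$ for all $j\neq i$, then $f$ is a distinguishing coloring of $G$.
   Context: The Cartesian product $G\square H$ has vertex set $V(G)\times V(H)$, with $(g,h)$, $(g',h')$ adjacent iff either $g=g'$ and $hh'\in E(H)$, or $gg'\in E(G)$ and $h=h'$. A graph is prime if it is not a Cartesian product of two non-trivial graphs; every connected graph has a unique prime factorization. A total coloring assigns a color to every vertex and every edge (no properness is required); vertex colorings and edge colorings are regarded as total colorings by giving all edges, respectively all vertices, one fixed color. A (vertex, edge or total) coloring is distinguishing if no automorphism other than the identity preserves it. Let $G=G_1\square\cdots\square G_k$ be the prime factorization, let $f$ be a total coloring of $G$, and write $Q_i = G_1\square\cdots\square G_{i-1}\square G_{i+1}\square\cdots\square G_k$, so $G\simeq G_i\square Q_i$. Fix an ordering of the vertices of each factor, $V(G_i)=\{1_i,2_i,\ldots,m_i\}$, where $1_r$ denotes the first vertex of $G_r$. For each vertex $j_i$ of $G_i$ put $u_j=(1_1,\ldots,1_{i-1},j_i,1_{i+1},\ldots,1_k)$ and let $Q_i^{u_j}$ be the $Q_i$-layer through $u_j$, i.e. the subgraph of $G$ induced by all vertices whose $i$-th coordinate is $j_i$ (it is isomorphic to $Q_i$). Vertex colors: let $\check{Q}_i^{u_j}=(Q_i^{u_j},f)$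 be the graph $Q_i^{u_j}$ with the total coloring obtained by restricting $f$. Two such colors $\check{Q}_i^{u_j}$ and $\check{Q}_i^{u_t}$ are equivalent if there is an isomorphism $Q_i^{u_j}\to Q_i^{u_t}$ preserving the total coloring. Edge colors: for an edge $e=u_iv_i$ of $G_i$, let $\overline{Q_i^e}$ be the graph isomorphic to $Q_i$ whose vertices are the edges of $G$ of the form $(u_i,x)(v_i,x)$, $x\in V(Q_i)$ (the edges of $G$ joining the vertices with $i$-th coordinate $u_i$ resp. $v_i$ and all other coordinates given by $x$), where $(u_i,x)(v_i,x)$ and $(u_i,y)(v_i,y)$ are adjacent iff $xy\in E(Q_i)$. Let $\hat{\overline{Q_i^e}}=(\overline{Q_i^e},f)$ be this graph with the vertex coloring in which $(u_i,x)(v_i,x)$ receives the color $f((u_i,x)(v_i,x))$. Two such colors $\hat{\overline{Q_i^e}}$ and $\hat{\overline{Q_i^{e'}}}$ are equivalent if there is a vertex-color-preserving isomorphism $\overline{Q_i^e}\to\overline{Q_i^{e'}}$. The reduced-factor coloring $G_i^f$ of $G_i$ induced by $f$ is the total coloring of $G_i$ in which the vertex $j_i$ (identified with $u_j$) is colored by $\check{Q}_i^{u_j}$ and each edge $e$ of $G_i$ is colored by $\hat{\overline{Q_i^e}}$; equivalent colors are regarded as the same color. The same notion of equivalence (existence of a color-preserving isomorphism) is used to compare colors coming from different factors. One writes $G_i^f\simeq G_j^f$ if there is an isomorphism $G_i\to G_j$ preserving these total colorings. -}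

module Defs where

open import Data.Empty using (⊥)
open import Data.Fin using (Fin; zero; suc; punchIn)
open import Data.Nat using (ℕ; zero; suc)
open import Data.Product using (Σ; ∃₂; _×_; _,_)
open import Data.Refinement using (Refinement; value)
open import Data.Sum using (_⊎_; inj₁; inj₂)
open import Data.Sum.Relation.Binary.Pointwise using (_⊎ₛ_; inj₁; inj₂)
open import Data.Unit using (⊤)
open import Function using (_∘_)
open import Function.Bundles using (_↔_; module Inverse)
open import Function.Construct.Composition using (_↔-∘_)
open import Function.Construct.Identity using (↔-id)
open import Function.Construct.Symmetry using (↔-sym)
open import Level using (Level; 0ℓ; _⊔_) renaming (suc to lsuc)
open import Relation.Binary.Bundles using (Setoid)
open import Relation.Binary.Core using (Rel)
open import Relation.Binary.Definitions using (Symmetric; Decidable)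
open import Relation.Binary.Construct.Closure.ReflexiveTransitive using (Star)
open import Relation.Binary.PropositionalEquality
  using (_≡_; _≢_; refl; sym)
open import Relation.Nullary using (¬_)

private
  variable
    c ℓ : Level

record Graph : Set₁ where
  infix 4 _~_
  field
    V      : Set
    _~_    : Rel V 0ℓ
    ~-sym  : Symmetric _~_
    ~-irr  : ∀ {v} → ¬ (v ~ v)

open Graph public using (V)

Adj : (G : Graph) → Rel (V G) 0ℓ
Adj = Graph._~_

-- Adjacency is also required to be decidable: this is part of what it means
-- for a graph to be given as a finite object.
record Finite (G : Graph) : Set where
  field
    order : ℕ
    enum  : V G ↔ Fin order
    adj?  : Decidable (Adj G)

Connected : Graph → Set
Connected G = ∀ u v → Star (Adj G) u v

Nontrivial : Graph → Set
Nontrivial G = ∃₂ λ (u v : V G) → u ≢ v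

induced : (G : Graph) → (V G → Set) → Graph
induced G P = record
  { V     = Refinement (V G) P
  ; _~_   = λ x y → value x ~ value y
  ; ~-sym = ~-sym
  ; ~-irr = ~-irr
  } where open Graph G using (_~_; ~-sym; ~-irr)

infix 4 _≅_
record _≅_ (G H : Graph) : Set where
  field
    bij    : V G ↔ V H
  open Inverse bij public using (to; from; strictlyInverseˡ; strictlyInverseʳ)
  field
    ~-to   : ∀ {u v} → Adj G u v → Adj H (to u) (to v)
    ~-from : ∀ {u v} → Adj H u v → Adj G (from u) (from v)

≅-refl : ∀ {G} → G ≅ G
≅-refl = record { bij = ↔-id _ ; ~-to = λ e → e ; ~-from = λ e → e }

≅-sym : ∀ {G H} → G ≅ H → H ≅ G
≅-sym φ = record { bij = ↔-sym bij ; ~-to = ~-from ; ~-from = ~-to }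
  where open _≅_ φ

≅-trans : ∀ {G H K} → G ≅ H → H ≅ K → G ≅ K
≅-trans φ ψ = record
  { bij    = _≅_.bij ψ ↔-∘ _≅_.bij φ
  ; ~-to   = _≅_.~-to ψ ∘ _≅_.~-to φ
  ; ~-from = _≅_.~-from φ ∘ _≅_.~-from ψ
  }

infixr 5 _□_
_□_ : Graph → Graph → Graph
G □ H = record
  { V     = V G × V H
  ; _~_   = λ (g , h) (g′ , h′) →
              (g ≡ g′ × Adj H h h′) ⊎ (Adj G g g′ × h ≡ h′)
  ; ~-sym = λ { (inj₁ (p , e)) → inj₁ (sym p , Graph.~-sym H e)
              ; (inj₂ (e , p)) → inj₂ (Graph.~-sym G e , sym p) }
  ; ~-irr = λ { (inj₁ (_ , e)) → Graph.~-irr H e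
              ; (inj₂ (e , _)) → Graph.~-irr G e }
  }

-- The one-vertex graph K₁ is the unit of _□_. As in the usual wording, it is
-- not excluded by this definition of primality.
Prime : Graph → Set₁
Prime G = ∀ A B → G ≅ A □ B → ¬ (Nontrivial A × Nontrivial B)

K₁ : Graph
K₁ = record { V = ⊤ ; _~_ = λ _ _ → ⊥ ; ~-sym = λ () ; ~-irr = λ () }

-- G₁ □ (G₂ □ (⋯ □ (Gₖ □ K₁))), so that vertices are nested tuples and
-- propositional equality on them is equality of all coordinates.
∏ : ∀ {k} → (Fin k → Graph) → Graph
∏ {zero}  G = K₁
∏ {suc k} G = G zero □ ∏ (G ∘ suc)

coord : ∀ {k} (G : Fin k → Graph) (i : Fin k) → V (∏ G) → V (G i)
coord G zero    (x , _)  = x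
coord G (suc i) (_ , xs) = coord (G ∘ suc) i xs

Q : ∀ {k} → (Fin (suc k) → Graph) → Fin (suc k) → Graph
Q G i = ∏ (G ∘ punchIn i)

-- insert G i u x is the vertex (u , x) of ∏ G ≃ G i □ Q G i.
insert : ∀ {k} (G : Fin (suc k) → Graph) (i : Fin (suc k)) →
         V (G i) → V (Q G i) → V (∏ G)
insert         G zero    u xs       = u , xs
insert {suc k} G (suc i) u (x , xs) = x , insert (G ∘ suc) i u xs

insert-adj : ∀ {k} (G : Fin (suc k) → Graph) (i : Fin (suc k)) {u v : V (G i)} →
             Adj (G i) u v → (x : V (Q G i)) →
             Adj (∏ G) (insert G i u x) (insert G i v x)
insert-adj         G zero    e xs       = inj₂ (e , refl)
insert-adj {suc k} G (suc i) e (x , xs) = inj₁ (refl , insert-adj (G ∘ suc) i e xs)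

-- Q_i^u: the layer of all vertices whose i-th coordinate is u.
Layer : ∀ {k} (G : Fin k → Graph) (i : Fin k) → V (G i) → Graph
Layer G i u = induced (∏ G) (λ x → coord G i x ≡ u)

-- Colors are taken from a setoid, since the colors of a reduced factor are
-- colored graphs considered up to equivalence. An edge color is a function of
-- the unordered pair of end vertices: edge is irrelevant in the adjacency proof
-- and symmetric.
record TotalColoring (G : Graph) (C : Setoid c ℓ) : Set (c ⊔ ℓ) where
  open Graph G using (_~_; ~-sym)
  open Setoid C using (Carrier; _≈_)
  field
    vertex   : V G → Carrier
    edge     : ∀ u v → .(u ~ v) → Carrier
    edge-sym : ∀ u v .(e : u ~ v) → edge u v e ≈ edge v u (~-sym e)

VertexColoring : Graph → Setoid c ℓ → Set c
VertexColoring G C = V G → Setoid.Carrier C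

restrict : {G : Graph} {C : Setoid c ℓ} (P : V G → Set) →
           TotalColoring G C → TotalColoring (induced G P) C
restrict P f = record
  { vertex   = λ x → vertex (value x)
  ; edge     = λ x y e → edge (value x) (value y) e
  ; edge-sym = λ x y e → edge-sym (value x) (value y) e
  } where open TotalColoring f

record Preserves {G H : Graph} {C : Setoid c ℓ} (φ : G ≅ H)
                 (f : TotalColoring G C) (g : TotalColoring H C) : Set ℓ where
  open _≅_ φ using (to; ~-to)
  open Setoid C using (_≈_)
  private
    module f = TotalColoring f
    module g = TotalColoring g
  field
    vertices : ∀ v → f.vertex v ≈ g.vertex (to v)
    edges    : ∀ u v .(e : Adj G u v) →
               f.edge u v e ≈ g.edge (to u) (to v) (~-to e)

Distinguishing : {G : Graph} {C : Setoid c ℓ} → TotalColoring G C → Set ℓ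
Distinguishing {G = G} f = (φ : G ≅ G) → Preserves φ f f → ∀ v → _≅_.to φ v ≡ v

TotallyColoredGraph : Setoid c ℓ → Set (lsuc 0ℓ ⊔ c ⊔ ℓ)
TotallyColoredGraph C = Σ Graph λ G → TotalColoring G C

VertexColoredGraph : Setoid c ℓ → Set (lsuc 0ℓ ⊔ c)
VertexColoredGraph C = Σ Graph λ G → VertexColoring G C

module _ (C : Setoid c ℓ) where
  private
    module C = Setoid C

  infix 4 _≃ᵗ_ _≃ᵛ_

  _≃ᵗ_ : Rel (TotallyColoredGraph C) ℓ
  (G , f) ≃ᵗ (H , g) = Σ (G ≅ H) λ φ → Preserves φ f g

  _≃ᵛ_ : Rel (VertexColoredGraph C) ℓ
  (G , f) ≃ᵛ (H , g) = Σ (G ≅ H) λ φ → ∀ v → f v C.≈ g (_≅_.to φ v)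

  private
    vertex-cong : {A : Set} (f : A → C.Carrier) → ∀ {u v} → u ≡ v → f u C.≈ f v
    vertex-cong f refl = C.refl

    edge-cong : {G : Graph} (f : TotalColoring G C) → let open TotalColoring f in
                ∀ {u u′ v v′} → u ≡ u′ → v ≡ v′ →
                .(e : Adj G u v) .(e′ : Adj G u′ v′) → edge u v e C.≈ edge u′ v′ e′
    edge-cong f refl refl e e′ = C.refl

    Preserves-sym : {G H : Graph} {f : TotalColoring G C} {g : TotalColoring H C}
                    (φ : G ≅ H) → Preserves φ f g → Preserves (≅-sym φ) g f
    Preserves-sym {f = f} {g} φ p = record
      { vertices = λ v → C.trans
          (vertex-cong (TotalColoring.vertex g) (sym (inv v)))
          (C.sym (vertices (from v)))
      ; edges    = λ u v e → C.trans
          (edge-cong g (sym (inv u)) (sym (inv v)) e (~-to (~-from e)))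
          (C.sym (edges (from u) (from v) (~-from e)))
      }
      where
      open Preserves p
      open _≅_ φ
      inv = strictlyInverseˡ

  TotallyColoredGraphs : Setoid (lsuc 0ℓ ⊔ c ⊔ ℓ) ℓ
  TotallyColoredGraphs = record
    { Carrier       = TotallyColoredGraph C
    ; _≈_           = _≃ᵗ_
    ; isEquivalence = record
      { refl  = ≅-refl , record { vertices = λ _ → C.refl ; edges = λ _ _ _ → C.refl }
      ; sym   = λ (φ , p) → ≅-sym φ , Preserves-sym φ p
      ; trans = λ (φ , p) (ψ , q) → ≅-trans φ ψ , record
          { vertices = λ v → C.trans (vertices p v) (vertices q _)
          ; edges    = λ u v e → C.trans (edges p u v e) (edges q _ _ (_≅_.~-to φ e))
          }
      }
    } where open Preserves

  VertexColoredGraphs : Setoid (lsuc 0ℓ ⊔ c) ℓ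
  VertexColoredGraphs = record
    { Carrier       = VertexColoredGraph C
    ; _≈_           = _≃ᵛ_
    ; isEquivalence = record
      { refl  = ≅-refl , λ _ → C.refl
      ; sym   = λ { {G , f} {H , g} (φ , p) → ≅-sym φ , λ v → C.trans
                  (vertex-cong g (sym (_≅_.strictlyInverseˡ φ v)))
                  (C.sym (p (_≅_.from φ v))) }
      ; trans = λ (φ , p) (ψ , q) → ≅-trans φ ψ , λ v → C.trans (p v) (q _)
      }
    }

  -- Vertices of a reduced factor are colored by elements of the first summand,
  -- edges by elements of the second.
  ReducedColors : Setoid (lsuc 0ℓ ⊔ c ⊔ ℓ) (lsuc 0ℓ ⊔ c ⊔ ℓ)
  ReducedColors = TotallyColoredGraphs ⊎ₛ VertexColoredGraphs

module _ {C : Setoid c ℓ} {k : ℕ} (G : Fin (suc k) → Graph)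
         (f : TotalColoring (∏ G) C) (i : Fin (suc k)) where

  vertexColor : V (G i) → TotallyColoredGraph C
  vertexColor u = Layer G i u , restrict (λ x → coord G i x ≡ u) f

  -- The vertex (u , x)(v , x) of the graph whose vertices are the edges of ∏ G
  -- over the edge uv of G i is represented by x; adjacency is that of Q G i.
  edgeColor : ∀ u v → .(Adj (G i) u v) → VertexColoredGraph C
  edgeColor u v e =
    Q G i , λ x → TotalColoring.edge f (insert G i u x) (insert G i v x) (insert-adj G i e x)

  reducedColoring : TotalColoring (G i) (ReducedColors C)
  reducedColoring = record
    { vertex   = λ u → inj₁ (vertexColor u)
    ; edge     = λ u v e → inj₂ (edgeColor u v e)
    ; edge-sym = λ u v e → inj₂
        (≅-refl , λ x → TotalColoring.edge-sym f _ _ (insert-adj G i e x))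
    }

  reducedFactor : TotallyColoredGraph (ReducedColors C)
  reducedFactor = G i , reducedColoring

{-# OPTIONS --safe #-}

-- A vertex set is two-convex when it contains every common neighbour of any two
-- of its distinct vertices.  In a Cartesian product, completing squares shows that a
-- connected two-convex set is a box.  A layer of a prime factor G i is connected and
-- two-convex, hence so is its image under an automorphism φ; as G i is prime, this
-- box extends in one direction j only.  Completing squares again shows that j does
-- not depend on the layer, so that φ acts on coordinate i by an isomorphism
-- G i ≅ G j.  This isomorphism preserves the reduced-factor colorings if φ preserves f,
-- so j ≡ i, and then it is the identity.
module Submission where

open import Defs
open import Data.Fin using (Fin; zero; suc)
import Data.Fin.Properties as Fin
open import Data.Irrelevant using ([_])
open import Data.Nat using (ℕ; zero; suc; _+_)
open import Data.Product using (∃; _×_; _,_; proj₁; proj₂)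
open import Data.Product.Properties using () renaming (≡-dec to ×-≡-dec)
open import Data.Refinement using (value; _,_)
open import Data.Refinement.Properties using (value-injective)
open import Data.Sum using (inj₁; inj₂)
open import Data.Sum.Relation.Binary.Pointwise using (inj₁; inj₂)
import Data.Unit.Properties as Unit
open import Function using (_∘_)
open import Function.Bundles using (mk↔ₛ′)
open import Function.Properties.Inverse using (Inverse⇒Injection)
open import Level using (Level)
open import Relation.Binary.Bundles using (Setoid)
open import Relation.Binary.Definitions using (DecidableEquality)
open import Relation.Binary.Construct.Closure.ReflexiveTransitive
  using (Star; ε; _◅_)
open import Relation.Binary.PropositionalEquality
  using (_≡_; _≢_; refl; sym; trans; cong; cong₂; subst; subst₂; ≢-sym)
open import Relation.Nullary using (¬_; Dec; yes; no; contradiction)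
open import Relation.Nullary.Decidable using (recompute; via-injection; decidable-stable)

private
  variable
    c ℓ : Level
    k : ℕ

-- Coordinates of vertices and directions of edges in a product.

coords-≡ : (G : Fin k → Graph) {x y : V (∏ G)} →
           (∀ i → coord G i x ≡ coord G i y) → x ≡ y
coords-≡ {zero}  G h = refl
coords-≡ {suc k} G h = cong₂ _,_ (h zero) (coords-≡ (G ∘ suc) (h ∘ suc))

∏-≟ : (G : Fin k → Graph) → (∀ i → DecidableEquality (V (G i))) →
      DecidableEquality (V (∏ G))
∏-≟ {zero}  G _≟_ = Unit._≟_
∏-≟ {suc k} G _≟_ = ×-≡-dec (_≟_ zero) (∏-≟ (G ∘ suc) (_≟_ ∘ suc))

update : (G : Fin k → Graph) (i : Fin k) → V (G i) → V (∏ G) → V (∏ G)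
update G zero    a (x , xs) = a , xs
update G (suc i) a (x , xs) = x , update (G ∘ suc) i a xs

coord-update : (G : Fin k → Graph) (i : Fin k) (a : V (G i)) (x : V (∏ G)) →
               coord G i (update G i a x) ≡ a
coord-update G zero    a x        = refl
coord-update G (suc i) a (_ , xs) = coord-update (G ∘ suc) i a xs

-- The relation of lying in a common layer of the factor `G i`; the graphs `Layer`, in contrast, are
-- copies of `Q G i`.
Agree : (G : Fin k → Graph) → Fin k → V (∏ G) → V (∏ G) → Set
Agree G i x y = ∀ l → l ≢ i → coord G l x ≡ coord G l y

Agree-update : (G : Fin k → Graph) (i : Fin k) (a : V (G i)) (x : V (∏ G)) →
               Agree G i x (update G i a x)
Agree-update G zero    a x        zero    l≢i = contradiction refl l≢i
Agree-update G zero    a x        (suc l) l≢i = refl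
Agree-update G (suc i) a x        zero    l≢i = refl
Agree-update G (suc i) a (_ , xs) (suc l) l≢i =
  Agree-update (G ∘ suc) i a xs l (l≢i ∘ cong suc)

-- An edge of direction `i`, stated coordinatewise so that no argument has to unfold the nested sums
-- in `Adj (∏ G)`.
Edge : (G : Fin k → Graph) → Fin k → V (∏ G) → V (∏ G) → Set
Edge G i x y = Adj (G i) (coord G i x) (coord G i y) × Agree G i x y

Adj⇒Edge : (G : Fin k → Graph) {x y : V (∏ G)} → Adj (∏ G) x y → ∃ λ i → Edge G i x y
Adj⇒Edge {suc k} G (inj₂ (e , refl)) =
  zero , e , λ { zero l≢0 → contradiction refl l≢0 ; (suc l) _ → refl }
Adj⇒Edge {suc k} G (inj₁ (refl , e)) with Adj⇒Edge (G ∘ suc) e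
... | i , e′ , agree = suc i , e′ , λ
  { zero _ → refl ; (suc l) l≢i → agree l (l≢i ∘ cong suc) }

Edge⇒Adj : (G : Fin k → Graph) (i : Fin k) {x y : V (∏ G)} → Edge G i x y → Adj (∏ G) x y
Edge⇒Adj G zero    (e , agree) = inj₂ (e , coords-≡ (G ∘ suc) λ l → agree (suc l) λ ())
Edge⇒Adj G (suc i) (e , agree) = inj₁
  ( agree zero (λ ())
  , Edge⇒Adj (G ∘ suc) i (e , λ l l≢i → agree (suc l) (l≢i ∘ Fin.suc-injective)) )

irrefl-≢ : (G : Graph) {u v : V G} → Adj G u v → u ≢ v
irrefl-≢ G e refl = Graph.~-irr G e

-- Splitting a vertex into one coordinate and the rest.

remove : (G : Fin (suc k) → Graph) (i : Fin (suc k)) → V (∏ G) → V (Q G i)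
remove         G zero    (x , xs) = xs
remove {suc k} G (suc i) (x , xs) = x , remove (G ∘ suc) i xs

coord-insert : (G : Fin (suc k) → Graph) (i : Fin (suc k)) (u : V (G i)) (x : V (Q G i)) →
               coord G i (insert G i u x) ≡ u
coord-insert         G zero    u x        = refl
coord-insert {suc k} G (suc i) u (_ , xs) = coord-insert (G ∘ suc) i u xs

remove-insert : (G : Fin (suc k) → Graph) (i : Fin (suc k)) (u : V (G i)) (x : V (Q G i)) →
                remove G i (insert G i u x) ≡ x
remove-insert         G zero    u x        = refl
remove-insert {suc k} G (suc i) u (x , xs) = cong (x ,_) (remove-insert (G ∘ suc) i u xs)

insert-remove : (G : Fin (suc k) → Graph) (i : Fin (suc k)) {u : V (G i)} (x : V (∏ G)) →
                coord G i x ≡ u → insert G i u (remove G i x) ≡ x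
insert-remove         G zero    x        refl = refl
insert-remove {suc k} G (suc i) (x , xs) eq   = cong (x ,_) (insert-remove (G ∘ suc) i xs eq)

Agree-insert : (G : Fin (suc k) → Graph) (i : Fin (suc k)) (u v : V (G i)) (x : V (Q G i)) →
               Agree G i (insert G i u x) (insert G i v x)
Agree-insert         G zero    u v x        zero    l≢i = contradiction refl l≢i
Agree-insert         G zero    u v x        (suc l) l≢i = refl
Agree-insert {suc k} G (suc i) u v x        zero    l≢i = refl
Agree-insert {suc k} G (suc i) u v (_ , xs) (suc l) l≢i =
  Agree-insert (G ∘ suc) i u v xs l (l≢i ∘ cong suc)

Agree⇒remove-≡ : (G : Fin (suc k) → Graph) (i : Fin (suc k)) {x y : V (∏ G)} →
                 Agree G i x y → remove G i x ≡ remove G i y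
Agree⇒remove-≡         G zero    agree = coords-≡ (G ∘ suc) λ l → agree (suc l) λ ()
Agree⇒remove-≡ {suc k} G (suc i) agree = cong₂ _,_ (agree zero λ ())
  (Agree⇒remove-≡ (G ∘ suc) i λ l l≢i → agree (suc l) (l≢i ∘ Fin.suc-injective))

Adj-insert : (G : Fin (suc k) → Graph) (i : Fin (suc k)) (u : V (G i)) {x y : V (Q G i)} →
             Adj (Q G i) x y → Adj (∏ G) (insert G i u x) (insert G i u y)
Adj-insert         G zero    u e                 = inj₁ (refl , e)
Adj-insert {suc k} G (suc i) u (inj₁ (refl , e)) = inj₁ (refl , Adj-insert (G ∘ suc) i u e)
Adj-insert {suc k} G (suc i) u (inj₂ (e , refl)) = inj₂ (e , refl)

Adj-remove : (G : Fin (suc k) → Graph) (i : Fin (suc k)) {x y : V (∏ G)} →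
             coord G i x ≡ coord G i y → Adj (∏ G) x y →
             Adj (Q G i) (remove G i x) (remove G i y)
Adj-remove         G zero    eq (inj₁ (_ , e))    = e
Adj-remove         G zero    eq (inj₂ (e , _))    = contradiction eq (irrefl-≢ (G zero) e)
Adj-remove {suc k} G (suc i) eq (inj₁ (refl , e)) = inj₁ (refl , Adj-remove (G ∘ suc) i eq e)
Adj-remove {suc k} G (suc i) eq (inj₂ (e , refl)) = inj₂ (e , refl)

-- Calculus of layers, coordinate changes and edge directions.

module _ (G : Fin k → Graph) where

  Agree-sym : ∀ {i x y} → Agree G i x y → Agree G i y x
  Agree-sym p l l≢i = sym (p l l≢i)

  Agree-trans : ∀ {i x y z} → Agree G i x y → Agree G i y z → Agree G i x z
  Agree-trans p q l l≢i = trans (p l l≢i) (q l l≢i)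

  Agree-reflexive : ∀ {i x y} → x ≡ y → Agree G i x y
  Agree-reflexive refl l l≢i = refl

  Agree⇒≡ : ∀ {i x y} → Agree G i x y → coord G i x ≡ coord G i y → x ≡ y
  Agree⇒≡ {i} agree eq = coords-≡ G λ l → case l (l Fin.≟ i)
    where
    case : ∀ l → Dec (l ≡ i) → coord G l _ ≡ coord G l _
    case l (yes refl) = eq
    case l (no l≢i)   = agree l l≢i

  Agree⇒update-≡ : ∀ {i a x y} → Agree G i x y → coord G i y ≡ a → update G i a x ≡ y
  Agree⇒update-≡ {i} {a} {x} agree eq =
    Agree⇒≡ (Agree-trans (Agree-sym (Agree-update G i a x)) agree)
            (trans (coord-update G i a x) (sym eq))

  update-cong : ∀ {i a x y} → Agree G i x y → update G i a x ≡ update G i a y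
  update-cong {i} {a} {y = y} agree =
    Agree⇒update-≡ (Agree-trans agree (Agree-update G i a y)) (coord-update G i a y)

  update-coord : ∀ i x → update G i (coord G i x) x ≡ x
  update-coord i x = Agree⇒update-≡ (λ _ _ → refl) refl

  coord-update-≢ : ∀ {i l} a x → l ≢ i → coord G l (update G i a x) ≡ coord G l x
  coord-update-≢ a x l≢i = sym (Agree-update G _ a x _ l≢i)

  Agree∧Adj⇒Edge : ∀ {i x y} → Agree G i x y → Adj (∏ G) x y → Edge G i x y
  Agree∧Adj⇒Edge {i} agree e with Adj⇒Edge G e
  ... | l , el , agreel with l Fin.≟ i
  ... | yes refl = el , agreel
  ... | no l≢i   = contradiction (agree l l≢i) (irrefl-≢ (G l) el)

  Edge-update : ∀ {i a b} x → Adj (G i) a b → Edge G i (update G i a x) (update G i b x)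
  Edge-update {i} {a} {b} x e =
    subst₂ (Adj (G i)) (sym (coord-update G i a x)) (sym (coord-update G i b x)) e ,
    Agree-trans (Agree-sym (Agree-update G i a x)) (Agree-update G i b x)

  Edge-updateˡ : ∀ {i b} x → Adj (G i) (coord G i x) b → Edge G i x (update G i b x)
  Edge-updateˡ {i} {b} x e =
    subst (Adj (G i) _) (sym (coord-update G i b x)) e , Agree-update G i b x

  -- Translation of an edge along another direction; it supplies the opposite side whenever a square
  -- is completed.
  Edge-update-≢ : ∀ {i l a x y} → l ≢ i → Edge G l x y → Edge G l (update G i a x) (update G i a y)
  Edge-update-≢ {i} {l} {a} {x} {y} l≢i (e , agree) =
    subst₂ (Adj (G l)) (Agree-update G i a x l l≢i) (Agree-update G i a y l l≢i) e , agree′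
    where
    agree′ : Agree G l (update G i a x) (update G i a y)
    agree′ m m≢l with m Fin.≟ i
    ... | yes refl = trans (coord-update G m a x) (sym (coord-update G m a y))
    ... | no m≢i   = trans (coord-update-≢ a x m≢i)
                       (trans (agree m m≢l) (sym (coord-update-≢ a y m≢i)))

  coord-path : ∀ i {x y} → Star (Adj (∏ G)) x y → Star (Adj (G i)) (coord G i x) (coord G i y)
  coord-path i ε = ε
  coord-path i {y = y} (e ◅ p) with Adj⇒Edge G e
  ... | l , el , agree with i Fin.≟ l
  ... | yes refl = el ◅ coord-path i p
  ... | no i≢l   = subst (λ a → Star (Adj (G i)) a (coord G i y)) (sym (agree i i≢l)) (coord-path i p)

  factor-connected : Connected (∏ G) → V (∏ G) → ∀ i → Connected (G i)
  factor-connected conn x i a b =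
    subst₂ (Star (Adj (G i))) (coord-update G i a x) (coord-update G i b x)
           (coord-path i (conn (update G i a x) (update G i b x)))

-- Two-convex sets and the box property.

TwoConvex : (G : Graph) → (V G → Set) → Set
TwoConvex G S = ∀ {x y z} → S x → S z → x ≢ z → Adj G x y → Adj G y z → S y

StepIn : (G : Graph) → (V G → Set) → V G → V G → Set
StepIn G S x y = S x × Adj G x y × S y

module _ (G : Fin k → Graph) where

  -- If one of the two edges has direction `i`, it keeps `y` in the layer of its end. If neither
  -- has, coordinate `i` is the same at `x` and `z`, and two such points of one layer coincide.
  layer-twoConvex : ∀ i v → TwoConvex (∏ G) (Agree G i v)
  layer-twoConvex i v {x} {y} {z} vx vz x≢z xy yz with Adj⇒Edge G xy | Adj⇒Edge G yz
  ... | l , exy , axy | m , eyz , ayz with l Fin.≟ i | m Fin.≟ i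
  ... | yes refl | _        = Agree-trans G vx axy
  ... | no _     | yes refl = Agree-trans G vz (Agree-sym G ayz)
  ... | no l≢i   | no m≢i   = contradiction
    (Agree⇒≡ G (Agree-trans G (Agree-sym G vx) vz)
               (trans (axy i (≢-sym l≢i)) (ayz i (≢-sym m≢i))))
    x≢z

  module _ (S : V (∏ G) → Set) (convex : TwoConvex (∏ G) S) (j : Fin k) where

    private
      Run : V (∏ G) → V (∏ G) → Set
      Run = Star (λ x y → Edge G j x y × S y)

      -- Induction on the run. The edge from `x` to `x′` and the first step of the run span a
      -- square. Its fourth vertex `w` is a common neighbour of two distinct points of `S`, so it
      -- lies in `S`, and the edge from `w` to the run has direction `l` again.
      shift-run : ∀ {l x x′ y} → l ≢ j → S x → Edge G l x x′ → Run x′ y →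
                  Run x (update G j (coord G j y) x)
      shift-run {x = x} l≢j Sx (_ , agree) ε =
        subst (Run x) (sym (Agree⇒update-≡ G (λ _ _ → refl) (agree j (≢-sym l≢j)))) ε
      shift-run {x = x} {x′} {z} l≢j Sx e@(_ , agree) (_◅_ {j = y} ((exy , axy) , Sy) p) =
        (xw , Sw) ◅ subst (Run w) (sym (update-cong G (Agree-update G j yj x)))
                      (shift-run l≢j Sw wy p)
        where
        yj = coord G j y
        w = update G j yj x
        xw : Edge G j x w
        xw = Edge-updateˡ G x (subst (λ a → Adj (G j) a yj) (sym (agree j (≢-sym l≢j))) exy)
        wy : Edge G _ w y
        wy = subst (Edge G _ w) (Agree⇒update-≡ G axy refl) (Edge-update-≢ G l≢j e)
        Sw : S w
        Sw = convex Sx Sy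
          (λ x≡y → irrefl-≢ (G j) exy (trans (sym (agree j (≢-sym l≢j))) (cong (coord G j) x≡y)))
          (Edge⇒Adj G j xw) (Edge⇒Adj G _ wy)

      -- Steps of direction `j` are kept; across any other step the run obtained from the remaining
      -- walk is shifted back.
      path⇒run : ∀ {x y} → Star (StepIn (∏ G) S) x y → Run x (update G j (coord G j y) x)
      path⇒run {x} ε = subst (Run x) (sym (update-coord G j x)) ε
      path⇒run {x} ((Sx , e , Sx′) ◅ p) with Adj⇒Edge G e
      ... | l , el with l Fin.≟ j
      ... | yes refl = subst (Run x) (sym (update-cong G (proj₂ el)))
                         ((el , Sx′) ◅ path⇒run p)
      ... | no l≢j   = subst (Run x) (cong (λ a → update G j a x) (coord-update G j _ _))
                         (shift-run l≢j Sx el (path⇒run p))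

      run-end : ∀ {x y} → S x → Run x y → S y
      run-end Sx ε              = Sx
      run-end _  ((_ , Sy) ◅ p) = run-end Sy p

    -- Applied one coordinate at a time, this makes a connected two-convex set the product of its
    -- projections.
    box : ∀ {x y} → S x → Star (StepIn (∏ G) S) x y → S (update G j (coord G j y) x)
    box Sx p = run-end Sx (path⇒run p)

-- Automorphisms that carry one coordinate to another.

module _ (G : Fin k → Graph) where

  -- The `agree` fields send layers of `G i` to layers of `G j`; the `coord` fields do the same for
  -- the complementary layers, on which that coordinate is constant. Both directions are recorded so
  -- that `φ` and its inverse can be treated alike.
  record Aligned (φ : ∏ G ≅ ∏ G) (i j : Fin k) : Set where
    open _≅_ φ using (to; from)
    field
      agree-to   : ∀ {x y} → Agree G i x y → Agree G j (to x) (to y)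
      agree-from : ∀ {x y} → Agree G j x y → Agree G i (from x) (from y)
      coord-to   : ∀ {x y} → coord G i x ≡ coord G i y → coord G j (to x) ≡ coord G j (to y)
      coord-from : ∀ {x y} → coord G j x ≡ coord G j y → coord G i (from x) ≡ coord G i (from y)

  Aligned-sym : ∀ {φ i j} → Aligned φ i j → Aligned (≅-sym φ) j i
  Aligned-sym al = record
    { agree-to = agree-from ; agree-from = agree-to ; coord-to = coord-from ; coord-from = coord-to }
    where open Aligned al

  module FactorIso {φ i j} (al : Aligned φ i j) (v : V (∏ G)) where
    open _≅_ φ
    open Aligned al

    private
      toᶠ : V (G i) → V (G j)
      toᶠ a = coord G j (to (update G i a v))

      fromᶠ : V (G j) → V (G i)
      fromᶠ b = coord G i (from (update G j b (to v)))

    -- By `coord-to`, coordinate `j` of the image is a function of coordinate `i` alone, so the map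
    -- read off on the layer through `v` describes `φ` everywhere.
    toᶠ-coord : ∀ x → coord G j (to x) ≡ toᶠ (coord G i x)
    toᶠ-coord x = coord-to (sym (coord-update G i _ v))

    private
      fromᶠ-coord : ∀ x → coord G i (from x) ≡ fromᶠ (coord G j x)
      fromᶠ-coord x = coord-from (sym (coord-update G j _ (to v)))

    iso : G i ≅ G j
    iso = record
      { bij    = mk↔ₛ′ toᶠ fromᶠ
          (λ b → trans (sym (toᶠ-coord _))
                   (trans (cong (coord G j) (strictlyInverseˡ _)) (coord-update G j b _)))
          (λ a → trans (sym (fromᶠ-coord _))
                   (trans (cong (coord G i) (strictlyInverseʳ _)) (coord-update G i a _)))
      -- The edge is lifted to the layer through `v`; its image stays inside one layer of `G j`,
      -- hence has direction `j`.
      ; ~-to   = λ e → let (e′ , agree) = Edge-update G v e in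
          proj₁ (Agree∧Adj⇒Edge G (agree-to agree) (~-to (Edge⇒Adj G i (e′ , agree))))
      ; ~-from = λ e → let (e′ , agree) = Edge-update G (to v) e in
          proj₁ (Agree∧Adj⇒Edge G (agree-from agree) (~-from (Edge⇒Adj G j (e′ , agree))))
      }

-- The image of a layer of a prime factor.

module _ (G : Fin k → Graph) (_≟_ : ∀ i → DecidableEquality (V (G i)))
         (prime : ∀ i → Prime (G i)) (conn : Connected (∏ G)) where

  private
    -- Membership in an induced subgraph is stored irrelevantly; decidable equality of coordinates
    -- recovers a usable proof.
    Agree-recompute : ∀ {i x y} → .(Agree G i x y) → Agree G i x y
    Agree-recompute {x = x} {y} agree l l≢i =
      recompute (_≟_ l (coord G l x) (coord G l y)) (agree l l≢i)

  module LayerImage (φ : ∏ G ≅ ∏ G) (v : V (∏ G)) (i j : Fin k) where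
    open _≅_ φ

    private
      w = to v
      wj = coord G j w

      point : V (G i) → V (∏ G)
      point a = to (update G i a v)

      S : V (∏ G) → Set
      S x = Agree G i v (from x)

      point∈S : ∀ a → S (point a)
      point∈S a = subst (Agree G i v) (sym (strictlyInverseʳ _)) (Agree-update G i a v)

      S⇒point : ∀ {x} → S x → point (coord G i (from x)) ≡ x
      S⇒point Sx = trans (cong to (Agree⇒update-≡ G Sx refl)) (strictlyInverseˡ _)

      S-twoConvex : TwoConvex (∏ G) S
      S-twoConvex {x} {y} {z} Sx Sz x≢z xy yz =
        layer-twoConvex G i v Sx Sz
          (λ eq → x≢z (trans (sym (strictlyInverseˡ x)) (trans (cong to eq) (strictlyInverseˡ z))))
          (~-from xy) (~-from yz)

      point-path : ∀ {a b} → Star (Adj (G i)) a b → Star (StepIn (∏ G) S) (point a) (point b)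
      point-path ε = ε
      point-path (_◅_ {i = a} {j = b} e p) =
        (point∈S a , ~-to (Edge⇒Adj G i (Edge-update G v e)) , point∈S b) ◅ point-path p

      -- The set `S` is the image of the `i`-layer through `v`, so the image of a walk in `G i`
      -- joins any two of its points inside `S`.
      S-box : ∀ {x y} → S x → S y → S (update G j (coord G j y) x)
      S-box Sx Sy = box G S S-twoConvex j Sx
        (subst₂ (Star (StepIn (∏ G) S)) (S⇒point Sx) (S⇒point Sy)
          (point-path (factor-connected G conn v i _ _)))

      w∈S : S w
      w∈S = Agree-reflexive G (sym (strictlyInverseʳ v))

      -- The two sides of the box `S`: `A` is its extent in direction `j` through `w`, and `B` its
      -- slice through `w` in all other directions.
      A B : Graph
      A = induced (G j) (λ a → S (update G j a w))
      B = induced (∏ G) (λ x → S x × coord G j x ≡ wj)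

      combine : V A → V B → V (∏ G)
      combine a x = update G j (value a) (value x)

      combine∈S : ∀ a x → S (combine a x)
      combine∈S (a , [ Sa ]) (x , [ Sx ]) =
        subst (λ b → S (update G j b x)) (coord-update G j a w)
          (S-box (Agree-recompute (proj₁ Sx)) (Agree-recompute Sa))

      B-coord : (x : V B) → coord G j (value x) ≡ wj
      B-coord (x , [ Sx ]) = recompute (_≟_ j _ _) (proj₂ Sx)

      partA : V (G i) → V A
      partA a = coord G j (point a) , [ S-box w∈S (point∈S a) ]

      partB : V (G i) → V B
      partB a = update G j wj (point a) , [ S-box (point∈S a) w∈S , coord-update G j wj _ ]

      -- The box property makes `combine` land in `S`, which `φ` identifies with `G i`. An image
      -- edge of direction `j` changes only the `A` part, any other only the `B` part.
      splitting : G i ≅ A □ B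
      splitting = record
        { bij    = mk↔ₛ′ (λ a → partA a , partB a)
            (λ (a , x) → coord G i (from (combine a x))) to-from from-to
        ; ~-to   = λ e → split-edge (~-to (Edge⇒Adj G i (Edge-update G v e)))
        ; ~-from = λ { {a , x} {b , y} e → proj₁ (Agree∧Adj⇒Edge G
            (Agree-trans G (Agree-sym G (combine∈S a x)) (combine∈S b y))
            (~-from (join-edge {a} {x} {b} {y} e))) }
        }
        where
        to-from : ∀ ((a , x) : V A × V B) →
                  let b = coord G i (from (combine a x)) in (partA b , partB b) ≡ (a , x)
        to-from (a , x) = cong₂ _,_
          (value-injective (trans (cong (coord G j) eq) (coord-update G j (value a) (value x))))
          (value-injective (trans (cong (update G j wj) eq)
            (Agree⇒update-≡ G (Agree-sym G (Agree-update G j (value a) (value x))) (B-coord x))))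
          where
          eq = S⇒point (combine∈S a x)

        from-to : ∀ a → coord G i (from (combine (partA a) (partB a))) ≡ a
        from-to a = trans
          (cong (coord G i) (trans
            (cong from (Agree⇒update-≡ G (Agree-sym G (Agree-update G j wj (point a))) refl))
            (strictlyInverseʳ _)))
          (coord-update G i a v)

        split-edge : ∀ {a b} → Adj (∏ G) (point a) (point b) →
                     Adj (A □ B) (partA a , partB a) (partA b , partB b)
        split-edge e with Adj⇒Edge G e
        ... | l , el , agree with l Fin.≟ j
        ... | yes refl = inj₂ (el , value-injective (update-cong G agree))
        ... | no l≢j   = inj₁ ( value-injective (agree j (≢-sym l≢j))
                              , Edge⇒Adj G l (Edge-update-≢ G l≢j (el , agree)) )

        join-edge : ∀ {a x b y} → Adj (A □ B) (a , x) (b , y) →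
                    Adj (∏ G) (combine a x) (combine b y)
        join-edge {a} {x} {b} {y} (inj₁ (refl , e)) with Adj⇒Edge G e
        ... | l , el , agree with l Fin.≟ j
        ... | yes refl = contradiction
              (trans (B-coord x) (sym (B-coord y))) (irrefl-≢ (G j) el)
        ... | no l≢j   = Edge⇒Adj G l (Edge-update-≢ G l≢j (el , agree))
        join-edge {x = x} (inj₂ (e , refl)) = Edge⇒Adj G j (Edge-update G (value x) e)

    -- The given edge at `w` makes `A` nontrivial, so by primality `B` has no vertex besides `w`.
    -- Hence every point of the image differs from `w` at most in coordinate `j`.
    layer-image : ∀ {a} → Edge G j w (to (update G i a v)) →
                  ∀ {x} → Agree G i v x → Agree G j w (to x)
    layer-image {a} (e , _) {x} agree =
      Agree-trans G
        -- Primality yields only a refutation of inequality; decidability turns it into an equality.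
        (Agree-reflexive G {j} (decidable-stable (∏-≟ G _≟_ w (value (partB b))) λ w≢ →
          prime i A B splitting
            ( ((coord G j w , [ S-box w∈S w∈S ]) , partA a , irrefl-≢ (G j) e ∘ cong value)
            , ((w , [ w∈S , refl ]) , partB b , w≢ ∘ cong value) )))
        (Agree-trans G (Agree-sym G (Agree-update G j wj (point b)))
          (Agree-reflexive G (cong to (Agree⇒update-≡ G agree refl))))
      where b = coord G i x

  open LayerImage using (layer-image)

  -- Spreading the direction of one image edge over the whole product.

  module _ (φ : ∏ G ≅ ∏ G) (i j : Fin k) where
    open _≅_ φ

    EdgesTo : V (∏ G) → Set
    EdgesTo x = ∀ {y} → Edge G i x y → Edge G j (to x) (to y)

    edge-edges : ∀ {x y} → Edge G i x y → Edge G j (to x) (to y) →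
                 ∀ {z} → Agree G i x z → EdgesTo z
    edge-edges {x} {y} (_ , xy) jxy {z} xz {u} (e , zu) =
      Agree∧Adj⇒Edge G
        (Agree-trans G (Agree-sym G (img xz)) (img (Agree-trans G xz zu)))
        (~-to (Edge⇒Adj G i (e , zu)))
      where
      img : ∀ {z} → Agree G i x z → Agree G j (to x) (to z)
      img = layer-image φ x i j {coord G i y}
        (subst (Edge G j (to x) ∘ to) (sym (Agree⇒update-≡ G xy refl)) jxy)

  module _ (φ : ∏ G ≅ ∏ G) (i j : Fin k) where
    open _≅_ φ

    private
      from-edge : ∀ {x y} → Edge G i x y → Edge G i (from (to x)) (from (to y))
      from-edge = subst₂ (Edge G i) (sym (strictlyInverseʳ _)) (sym (strictlyInverseʳ _))

      to-injective : ∀ {x y} → to x ≡ to y → x ≡ y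
      to-injective eq =
        trans (sym (strictlyInverseʳ _)) (trans (cong from eq) (strictlyInverseʳ _))

    -- The square is mapped to a 4-cycle with one side of direction `j`. The cases run over the
    -- directions `p`, `q`, `r` of the other three sides and exclude `r ≢ j`.
    parallel-edge : ∀ {l x x′ y y′} → l ≢ i → Edge G l x x′ → Edge G l y y′ →
                    Edge G i x y → Edge G i x′ y′ →
                    Edge G j (to x) (to y) → Edge G j (to x′) (to y′)
    parallel-edge {l} {x} {x′} {y} {y′} l≢i xx′ yy′ xy x′y′ jxy
      with Adj⇒Edge G (~-to (Edge⇒Adj G l xx′))
         | Adj⇒Edge G (~-to (Edge⇒Adj G l yy′))
         | Adj⇒Edge G (~-to (Edge⇒Adj G i x′y′))
    ... | p , e₁ , a₁ | q , e₂ , a₂ | r , e₃ , a₃ with p Fin.≟ j | q Fin.≟ j | r Fin.≟ j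
    ... | _        | _        | yes refl = e₃ , a₃
    -- the j-layer through (to x) is the image of the i-layer through x, which avoids x′
    ... | yes refl | _        | no _     = contradiction
            (proj₂ (edge-edges (≅-sym φ) j i jxy (from-edge xy) (λ _ _ → refl) (e₁ , a₁)) l l≢i)
            (irrefl-≢ (G l) (subst₂ (λ u v → Adj (G l) (coord G l u) (coord G l v))
              (sym (strictlyInverseʳ _)) (sym (strictlyInverseʳ _)) (proj₁ xx′)))
    -- Coordinate `j` would stay constant on the way from `to x` over `to x′` and `to y′` to `to y`.
    ... | no p≢j   | no q≢j   | no r≢j   = contradiction
            (trans (a₁ j (≢-sym p≢j)) (trans (a₃ j (≢-sym r≢j)) (sym (a₂ j (≢-sym q≢j)))))
            (irrefl-≢ (G j) (proj₁ jxy))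
    -- Passing over `to y`, the corners `to x` and `to y′` agree outside `j`; passing over `to x′`,
    -- they agree in `j`. Opposite corners of the square would coincide.
    ... | no p≢j   | yes refl | no r≢j   = contradiction
            (cong (coord G i) (to-injective (Agree⇒≡ G (Agree-trans G (proj₂ jxy) a₂)
              (trans (a₁ j (≢-sym p≢j)) (a₃ j (≢-sym r≢j))))))
            (λ eq → irrefl-≢ (G i) (proj₁ x′y′) (trans (sym (proj₂ xx′ i (≢-sym l≢i))) eq))

    edges-step : ∀ {x x′} → Adj (∏ G) x x′ → EdgesTo φ i j x → EdgesTo φ i j x′
    edges-step {x} {x′} e D {y′} x′y′ with Adj⇒Edge G e
    ... | l , xx′ with l Fin.≟ i
    ... | yes refl = edge-edges φ i j xx′ (D xx′) (proj₂ xx′) x′y′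
    ... | no l≢i   = parallel-edge l≢i xx′ yy′ xy x′y′ (D xy)
      where
      b = coord G i y′
      -- The fourth corner of the square on `x`, `x′` and `y′`.
      y = update G i b x
      yy′ : Edge G l y y′
      yy′ = subst (Edge G l y) (Agree⇒update-≡ G (proj₂ x′y′) refl) (Edge-update-≢ G l≢i xx′)
      xy : Edge G i x y
      xy = Edge-updateˡ G x
        (subst (λ a → Adj (G i) a b) (sym (proj₂ xx′ i (≢-sym l≢i))) (proj₁ x′y′))

    edges-everywhere : ∀ {x y} → Edge G i x y → Edge G j (to x) (to y) → ∀ z → EdgesTo φ i j z
    edges-everywhere {x} xy jxy z = along (conn x z) (edge-edges φ i j xy jxy (λ _ _ → refl))
      where
      along : ∀ {x z} → Star (Adj (∏ G)) x z → EdgesTo φ i j x → EdgesTo φ i j z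
      along ε       D = D
      along (e ◅ p) D = along p (edges-step e D)

  -- From edge directions to layers and coordinates.

  module _ (φ : ∏ G ≅ ∏ G) (i j : Fin k) where
    open _≅_ φ

    edges⇒agree : (∀ x → EdgesTo φ i j x) → ∀ {x y} → Agree G i x y → Agree G j (to x) (to y)
    edges⇒agree D {x} {y} agree = subst₂ (λ u v → Agree G j (to u) (to v))
        (update-coord G i x) (Agree⇒update-≡ G agree refl)
        (along (factor-connected G conn x i _ _))
      where
      along : ∀ {a b} → Star (Adj (G i)) a b →
              Agree G j (to (update G i a x)) (to (update G i b x))
      along ε       l l≢j = refl
      along (e ◅ p) l l≢j = trans (proj₂ (D _ (Edge-update G x e)) l l≢j) (along p l l≢j)

    -- A walk from `x` to `y` is projected by freezing coordinate `i`, which collapses its steps of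
    -- direction `i`. No other step can go to direction `j`, because the inverse sends direction `j`
    -- to direction `i`; so coordinate `j` of the image never changes.
    edges⇒coord : (∀ x → EdgesTo (≅-sym φ) j i x) →
                  ∀ {x y} → coord G i x ≡ coord G i y → coord G j (to x) ≡ coord G j (to y)
    edges⇒coord D {x} {y} eq =
      subst₂ (λ u v → coord G j (to u) ≡ coord G j (to v))
        (update-coord G i x) (Agree⇒update-≡ G (λ _ _ → refl) (sym eq))
        (along (coord G i x) (conn x y))
      where
      step : ∀ {l x y} → l ≢ i → Edge G l x y → coord G j (to x) ≡ coord G j (to y)
      step {l} l≢i (e , agree) with Adj⇒Edge G (~-to (Edge⇒Adj G l (e , agree)))
      ... | m , em , agreem with m Fin.≟ j
      ... | yes refl = contradiction
            (subst₂ (λ u v → coord G l u ≡ coord G l v) (strictlyInverseʳ _) (strictlyInverseʳ _)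
              (proj₂ (D _ (em , agreem)) l l≢i))
            (irrefl-≢ (G l) e)
      ... | no m≢j = agreem j (≢-sym m≢j)

      along : ∀ {x y} a → Star (Adj (∏ G)) x y →
              coord G j (to (update G i a x)) ≡ coord G j (to (update G i a y))
      along a ε = refl
      along {y = y} a (e ◅ p) with Adj⇒Edge G e
      ... | l , el with l Fin.≟ i
      ... | yes refl = trans (cong (coord G j ∘ to) (update-cong G (proj₂ el))) (along a p)
      ... | no l≢i   = trans (step l≢i (Edge-update-≢ G l≢i el)) (along a p)

  -- A single edge decides: it fixes the direction of the images of all `i`-edges under `φ` and,
  -- read backwards, of all `j`-edges under the inverse.
  aligned : (φ : ∏ G ≅ ∏ G) → let open _≅_ φ in
            ∀ {i j x y} → Edge G i x y → Edge G j (to x) (to y) → Aligned G φ i j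
  aligned φ {i} {j} xy jxy = record
    { agree-to   = edges⇒agree φ i j D
    ; agree-from = edges⇒agree (≅-sym φ) j i D⁻¹
    ; coord-to   = edges⇒coord φ i j D⁻¹
    ; coord-from = edges⇒coord (≅-sym φ) j i D
    }
    where
    open _≅_ φ
    D = edges-everywhere φ i j xy jxy
    D⁻¹ = edges-everywhere (≅-sym φ) j i jxy
      (subst₂ (Edge G i) (sym (strictlyInverseʳ _)) (sym (strictlyInverseʳ _)) xy)

-- Reduced-factor colorings under an aligned automorphism.

edge-cong : {C : Setoid c ℓ} {G : Graph} (f : TotalColoring G C) →
            let open TotalColoring f; open Setoid C in
            ∀ {u u′ v v′} → u ≡ u′ → v ≡ v′ →
            .(e : Adj G u v) .(e′ : Adj G u′ v′) → edge u v e ≈ edge u′ v′ e′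
edge-cong {C = C} f refl refl e e′ = Setoid.refl C

module _ {C : Setoid c ℓ} (G : Fin (suc k) → Graph) (f : TotalColoring (∏ G) C)
         {φ : ∏ G ≅ ∏ G} (p : Preserves φ f f) {i j : Fin (suc k)}
         (al : Aligned G φ i j) (v : V (∏ G)) where
  open _≅_ φ
  open Aligned al
  open FactorIso G al v
  private
    module I = _≅_ iso
    module C = Setoid C

    from-coord : ∀ {u} x → coord G j x ≡ I.to u → coord G i (from x) ≡ u
    from-coord {u} x eq = trans (sym (I.strictlyInverseʳ _))
      (trans (cong I.from (trans (sym (toᶠ-coord (from x)))
                            (trans (cong (coord G j) (strictlyInverseˡ x)) eq)))
             (I.strictlyInverseʳ u))

    layer-iso : ∀ u → Layer G i u ≅ Layer G j (I.to u)
    layer-iso u = record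
      { bij    = mk↔ₛ′
          (λ (x , [ eq ]) → to x , [ trans (toᶠ-coord x) (cong I.to eq) ])
          (λ (x , [ eq ]) → from x , [ from-coord x eq ])
          (λ x → value-injective (strictlyInverseˡ (value x)))
          (λ x → value-injective (strictlyInverseʳ (value x)))
      ; ~-to   = ~-to
      ; ~-from = ~-from
      }

    insert-to : ∀ u x → insert G j (I.to u) (remove G j (to (insert G i u x))) ≡ to (insert G i u x)
    insert-to u x = insert-remove G j _
      (trans (toᶠ-coord _) (cong I.to (coord-insert G i u x)))

    insert-from : ∀ u x → insert G i u (remove G i (from (insert G j (I.to u) x)))
                          ≡ from (insert G j (I.to u) x)
    insert-from u x = insert-remove G i _ (from-coord _ (coord-insert G j _ x))

    -- This is `φ` on the copy of `Q G i` over `u`, read in the copy of `Q G j` over the image of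
    -- `u`.
    Q-iso : V (G i) → Q G i ≅ Q G j
    Q-iso u = record
      { bij    = mk↔ₛ′
          (λ x → remove G j (to (insert G i u x)))
          (λ x → remove G i (from (insert G j (I.to u) x)))
          (λ x → trans (cong (remove G j) (trans (cong to (insert-from u x)) (strictlyInverseˡ _)))
                       (remove-insert G j _ x))
          (λ x → trans (cong (remove G i) (trans (cong from (insert-to u x)) (strictlyInverseʳ _)))
                       (remove-insert G i u x))
      ; ~-to   = λ {x} {y} e → Adj-remove G j
          (coord-to (trans (coord-insert G i u x) (sym (coord-insert G i u y))))
          (~-to (Adj-insert G i u e))
      ; ~-from = λ {x} {y} e → Adj-remove G i
          (coord-from (trans (coord-insert G j _ x) (sym (coord-insert G j _ y))))
          (~-from (Adj-insert G j _ e))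
      }

  reduced-preserves : Preserves iso (reducedColoring G f i) (reducedColoring G f j)
  reduced-preserves = record
    { vertices = λ u → inj₁ (layer-iso u , record
        { vertices = λ x → Preserves.vertices p (value x)
        ; edges    = λ x y e → Preserves.edges p (value x) (value y) e })
    ; edges    = λ u u′ e → inj₂ (Q-iso u , λ x → C.trans
        (Preserves.edges p _ _ (insert-adj G i e x))
        (edge-cong f (sym (insert-to u x))
          -- By `agree-to`, the images of both ends of the edge have the same part in `Q G j`, so
          -- the isomorphism built at `u` also fits the end `u′`.
          (trans (sym (insert-to u′ x)) (cong (insert G j (I.to u′))
            (Agree⇒remove-≡ G j (agree-to (Agree-insert G i u′ u x)))))
          (~-to (insert-adj G i e x)) (insert-adj G j (I.~-to e) _)))
    }

lemma4p1 : ∀ {c ℓ} (C : Setoid c ℓ) (n : ℕ) (G : Fin (2 + n) → Graph) →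
    (∀ i → Finite (G i)) → (∀ i → Prime (G i)) → Connected (∏ G) →
    (f : TotalColoring (∏ G) C) →
    (∀ i → Distinguishing (reducedColoring G f i)) →
    (∀ i j → j ≢ i → ¬ (_≃ᵗ_ (ReducedColors C) (reducedFactor G f i) (reducedFactor G f j))) →
    Distinguishing f
lemma4p1 C n G fin prime conn f dist noniso φ pres v =
  -- A factor may be a single vertex without edges. Assuming coordinate `i` of `v` is moved gives
  -- `G i` a second vertex, hence by connectedness an edge of direction `i` at `v`; the direction of
  -- its image is `j`.
  coords-≡ G λ i → decidable-stable (_≟_ i _ _) λ moved →
    let (a , e)   = neighbour (factor-connected G conn v i _ _) (≢-sym moved)
        va        = Edge-updateˡ G v e
        (j , jva) = Adj⇒Edge G (~-to (Edge⇒Adj G i va))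
    in moved (fixed (aligned G _≟_ prime conn φ va jva))
  where
  open _≅_ φ

  _≟_ : ∀ i → DecidableEquality (V (G i))
  _≟_ i = via-injection (Inverse⇒Injection (Finite.enum (fin i))) Fin._≟_

  neighbour : ∀ {i u w} → Star (Adj (G i)) u w → u ≢ w → ∃ λ a → Adj (G i) u a
  neighbour ε       u≢w = contradiction refl u≢w
  neighbour (e ◅ _) _   = _ , e

  fixed : ∀ {i j} → Aligned G φ i j → coord G i (to v) ≡ coord G i v
  fixed {i} {j} al with j Fin.≟ i
  ... | no j≢i   = contradiction
        (FactorIso.iso G al v , reduced-preserves G f pres al v) (noniso i j j≢i)
  ... | yes refl = trans (FactorIso.toᶠ-coord G al v v)
        (dist i (FactorIso.iso G al v) (reduced-preserves G f pres al v) _)
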